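{- Let $u\ge1$ be an integer, $p=q=1/2$, and let $X_{n,s}$ be the number of turns required to end the single-player pile game with boundary with set of choices $R=\{1,-u\}$ and target $n$, starting with $s$ chips. Then $$E[X_{n,s}]=2\,[C_u(n)-C_u(s)],\qquad 0\le s\le n,$$ where $C_u$ is defined by $C_u(0)=C_u(-1)=\dots=C_u(-u)=0$ and $$C_u(n)=2C_u(n-1)+1-C_u(n-u-1)\qquad(n\ge1).$$
   Context: Single-player pile game with boundary, $R=\{1,-u\}$: the player starts with $s$ chips, $0\le s\le n$. In each turn, independently, the number of chips $c$ is replaced by $c+1$ with probability $p$ and by $\max(0,c-u)$ with probability $q=1-p$. The game ends when the player first has $n$ chips (at turn $0$ if $s=n$). -}

module Defs where

open import Data.Bool.Base using (Bool; not; _∧_; if_then_else_)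
open import Data.Nat.Base as ℕ using (ℕ; zero; suc)
import Data.Nat.Properties as ℕ
open import Data.Integer.Base as ℤ using (ℤ; +_; -[1+_]; _⊖_; 0ℤ)
import Data.Integer.Properties as ℤ
open import Data.Rational.Base as ℚ using (ℚ; 0ℚ; 1ℚ; _/_)
open import Data.Product.Base using (∃-syntax; _×_)
open import Data.Vec.Base using (Vec; []; _∷_)
open import Relation.Nullary.Decidable.Core using (does)
open import Relation.Binary.PropositionalEquality

data Turn : Set where
  win lose : Turn

move : (u : ℕ) → Turn → ℕ → ℕ
move u win  c = c ℕ.+ 1
move u lose c = c ℕ.∸ u   -- truncated subtraction: max(0, c − u)

-- Expectation over k independent turns, each `win` with probability p and
-- `lose` with probability 1 − p.
𝔼 : (p : ℚ) (k : ℕ) → (Vec Turn k → ℚ) → ℚ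
𝔼 p zero    f = f []
𝔼 p (suc k) f = p            ℚ.* 𝔼 p k (λ w → f (win ∷ w))
          ℚ.+ (1ℚ ℚ.- p) ℚ.* 𝔼 p k (λ w → f (lose ∷ w))

ℙ : (p : ℚ) (k : ℕ) → (Vec Turn k → Bool) → ℚ
ℙ p k A = 𝔼 p k (λ w → if A w then 1ℚ else 0ℚ)

-- Starting with c chips, the player has n chips after all the turns of the
-- word, and not at any earlier time (time 0 included).
endsNow : (u n c : ℕ) {k : ℕ} → Vec Turn k → Bool
endsNow u n c []      = does (c ℕ.≟ n)
endsNow u n c (t ∷ w) = not (does (c ℕ.≟ n)) ∧ endsNow u n (move u t c) w

-- k ↦ P(X_{n,s} = k).  The event {X = k} depends on the first k turns only,
-- so its probability is that of a set of words of length k.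
law : (p : ℚ) (u n s : ℕ) → ℕ → ℚ
law p u n s k = ℙ p k (endsNow u n s)

-- partialSum f N is the sum of f k over k < N.
partialSum : (ℕ → ℚ) → ℕ → ℚ
partialSum f zero    = 0ℚ
partialSum f (suc N) = partialSum f N ℚ.+ f N

_⟶_ : (ℕ → ℚ) → ℚ → Set
a ⟶ l = ∀ (ε : ℚ) → 0ℚ ℚ.< ε →
  ∃[ N ] (∀ m → N ℕ.≤ m → ℚ.∣ a m ℚ.- l ∣ ℚ.< ε)

-- E[X] = e for a random variable X with values in ℕ ∪ {∞} and P(X = k) = f k.
-- The first component says P(X = ∞) = 0, without which E[X] would be infinite.
HasExpectation : (f : ℕ → ℚ) (e : ℚ) → Set
HasExpectation f e =
    (partialSum f ⟶ 1ℚ)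
  × (partialSum (λ k → (+ k / 1) ℚ.* f k) ⟶ e)

-- Cback u n j is C_u(n − j), which is 0 when n ≤ j; keeping j separate makes
-- the order-(u + 1) recurrence structural.
Cback : (u n j : ℕ) → ℤ
Cback u zero    j       = 0ℤ
Cback u (suc n) (suc j) = Cback u n j
Cback u (suc n) zero    = + 2 ℤ.* Cback u n 0 ℤ.+ + 1 ℤ.- Cback u n u

-- C_u, extended by 0 to the arguments below −u, which the recurrence for
-- n ≥ 1 never reaches.
C : (u : ℕ) → ℤ → ℤ
C u (+ n)    = Cback u n 0
C u -[1+ _ ] = 0ℤ

Cback-C : ∀ u n j → Cback u n j ≡ C u (+ n ℤ.- + j)
Cback-C u n j = trans (go n j) (cong (C u) (sym (ℤ.m-n≡m⊖n n j)))
  where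
  go : ∀ n j → Cback u n j ≡ C u (n ⊖ j)
  go zero    zero    = refl
  go zero    (suc j) = refl
  go (suc n) zero    = refl
  go (suc n) (suc j) = trans (go n j) (cong (C u) (sym (ℤ.[1+m]⊖[1+n]≡m⊖n n j)))

C-initial : ∀ u i → ℤ.- (+ u) ℤ.≤ i → i ℤ.≤ 0ℤ → C u i ≡ 0ℤ
C-initial u (+ zero)  _ _ = refl
C-initial u (+ suc _) _ (ℤ.+≤+ ())
C-initial u -[1+ _ ]  _ _ = refl

C-recurrence : ∀ u n → 1 ℕ.≤ n →
  C u (+ n) ≡ + 2 ℤ.* C u (+ n ℤ.- + 1) ℤ.+ + 1 ℤ.- C u (+ n ℤ.- + u ℤ.- + 1)
C-recurrence u (suc n) _ =
  cong (λ y → + 2 ℤ.* Cback u n 0 ℤ.+ + 1 ℤ.- y)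
    (trans (Cback-C u n u) (cong (C u) shift))
  where
  shift : + n ℤ.- + u ≡ + suc n ℤ.- + u ℤ.- + 1
  shift = begin
    + n ℤ.- + u                       ≡⟨⟩
    + suc n ℤ.- + 1 ℤ.- + u           ≡⟨ ℤ.+-assoc (+ suc n) (ℤ.- + 1) (ℤ.- + u) ⟩
    + suc n ℤ.+ (ℤ.- + 1 ℤ.- + u)     ≡⟨ cong (λ z → + suc n ℤ.+ z) (ℤ.+-comm (ℤ.- + 1) (ℤ.- + u)) ⟩
    + suc n ℤ.+ (ℤ.- + u ℤ.- + 1)     ≡⟨ sym (ℤ.+-assoc (+ suc n) (ℤ.- + u) (ℤ.- + 1)) ⟩
    + suc n ℤ.- + u ℤ.- + 1           ∎
    where open ≡-Reasoning

{-# OPTIONS --safe #-}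
-- The function V s = 2 (C n − C s) solves V s = 1 + ½ V (s + 1) + ½ V (s ∸ u)
-- with V n = 0, and it is bounded on [0, n] because C is nondecreasing.  Both
-- the tail T N s = 1 − P(X < N) and the defect W N s = V s − E[X; X < N] obey
-- the same recurrence in N, with a nonnegative source term, so the sums of
-- each over N are bounded by a multiple of 1 + V.  A nonnegative nonincreasing
-- sequence with bounded sums is O(1/N), which gives both limits.
module Submission where

open import Data.Bool.Base using (true; false; if_then_else_)
open import Data.Nat.Base as ℕ using (ℕ; zero; suc; _≤_; _∸_; z≤n; s≤s)
import Data.Nat.Properties as ℕ
open import Data.Integer.Base as ℤ using (ℤ; +_; -[1+_]; _-_; _*_; 0ℤ)
import Data.Integer.Properties as ℤ
import Data.Integer.Tactic.RingSolver as ℤ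
open import Data.Nat.Coprimality using (sym; 1-coprimeTo)
open import Data.Product.Base using (∃-syntax; _,_)
open import Data.Rational.Base as ℚ using (ℚ; mkℚ; 0ℚ; 1ℚ; ½; _/_; NonNegative; nonNegative; positive)
import Data.Rational.Properties as ℚ
open import Data.Rational.Solver using (module +-*-Solver)
open import Data.Sum.Base using (inj₁; inj₂)
open import Data.Vec.Base using (_∷_)
open import Relation.Binary.PropositionalEquality as ≡ hiding (sym)
open import Relation.Nullary.Decidable using (dec-true; dec-false)
open import Defs

open +-*-Solver using (solve; _:+_; _:*_; _:-_; :-_; _:=_; con)

-- Integers inside the rationals, the Archimedean property and a convergence criterion.

ι : ℤ → ℚ
ι i = i / 1

-- `i / 1` is stuck on its gcd normalisation when `i` is a variable; rewriting to `mkℚ` exposes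
-- numerator and denominator.
ι-mkℚ : ∀ i → ι i ≡ mkℚ i 0 (sym (1-coprimeTo ℤ.∣ i ∣))
ι-mkℚ i = ℚ.↥p/↧p≡p (mkℚ i 0 (sym (1-coprimeTo ℤ.∣ i ∣)))

ι-+ : ∀ i j → ι (i ℤ.+ j) ≡ ι i ℚ.+ ι j
ι-+ i j rewrite ι-mkℚ i | ι-mkℚ j =
  cong ι (≡.sym (cong₂ ℤ._+_ (ℤ.*-identityʳ i) (ℤ.*-identityʳ j)))

ι-mono : ∀ {i j} → i ℤ.≤ j → ι i ℚ.≤ ι j
ι-mono {i} {j} i≤j rewrite ι-mkℚ i | ι-mkℚ j =
  ℚ.*≤* (ℤ.*-monoʳ-≤-nonNeg (+ 1) i≤j)

ι-suc : ∀ k → ι (+ suc k) ≡ 1ℚ ℚ.+ ι (+ k)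
ι-suc k = ι-+ (+ 1) (+ k)

ι-nonNeg : ∀ k → NonNegative (ι (+ k))
ι-nonNeg k = nonNegative (ι-mono {+ 0} {+ k} (ℤ.+≤+ z≤n))

<ι : ∀ x → ∃[ N ] x ℚ.< ι (+ N)
<ι (mkℚ i d _) = N , lt
  where
  -- The denominator is at least 1, so any integer above `∣ i ∣` exceeds the fraction.
  N = suc ℤ.∣ i ∣
  i≤∣i∣ : ∀ i → i ℤ.≤ + ℤ.∣ i ∣
  i≤∣i∣ (+ _)      = ℤ.≤-refl
  i≤∣i∣ (-[1+ _ ]) = ℤ.-≤+
  lt : mkℚ i d _ ℚ.< ι (+ N)
  lt rewrite ι-mkℚ (+ N) = ℚ.*<* (begin-strict
    i ℤ.* + 1         ≡⟨ ℤ.*-identityʳ i ⟩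
    i                 ≤⟨ i≤∣i∣ i ⟩
    + ℤ.∣ i ∣         <⟨ ℤ.+<+ (ℕ.n<1+n _) ⟩
    + N               ≤⟨ ℤ.+≤+ (ℕ.m≤m*n N (suc d)) ⟩
    + (N ℕ.* suc d)   ≡⟨ ℤ.pos-* N (suc d) ⟩
    + N ℤ.* + suc d   ∎)
    where open ℤ.≤-Reasoning

archimedean : ∀ B ε → 0ℚ ℚ.< ε → ∃[ N ] B ℚ.< ι (+ N) ℚ.* ε
archimedean B ε 0<ε with <ι (B ℚ.* (ℚ.1/ ε) {{ℚ.>-nonZero 0<ε}})
... | N , B/ε<N = N , (begin-strict
  B                       ≡⟨ ℚ.*-identityʳ B ⟨
  B ℚ.* 1ℚ                ≡⟨ cong (B ℚ.*_) (ℚ.*-inverseˡ ε) ⟨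
  B ℚ.* (ℚ.1/ ε ℚ.* ε)    ≡⟨ ℚ.*-assoc B (ℚ.1/ ε) ε ⟨
  B ℚ.* ℚ.1/ ε ℚ.* ε      <⟨ ℚ.*-monoˡ-<-pos ε {{positive 0<ε}} B/ε<N ⟩
  ι (+ N) ℚ.* ε           ∎)
  where
  open ℚ.≤-Reasoning
  instance _ = ℚ.>-nonZero 0<ε

-- For `m ≥ N`, `m (l - a m) ≤ B < N ε ≤ m ε`, and `m` cancels. Strictness already excludes `m = 0`.
⟶-by-1/N : ∀ a l B → (∀ N → 0ℚ ℚ.≤ l ℚ.- a N) →
  (∀ N → ι (+ N) ℚ.* (l ℚ.- a N) ℚ.≤ B) → a ⟶ l
⟶-by-1/N a l B 0≤l-a bound ε 0<ε with archimedean B ε 0<ε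
... | N , B<Nε = N , λ m N≤m →
  subst (ℚ._< ε) (≡.sym (distance m))
    (ℚ.*-cancelˡ-<-nonNeg (ι (+ m)) {{ι-nonNeg m}} (begin-strict
      ι (+ m) ℚ.* (l ℚ.- a m) ≤⟨ bound m ⟩
      B                       <⟨ B<Nε ⟩
      ι (+ N) ℚ.* ε           ≤⟨ ℚ.*-monoʳ-≤-nonNeg ε {{nonNegative (ℚ.<⇒≤ 0<ε)}} (ι-mono (ℤ.+≤+ N≤m)) ⟩
      ι (+ m) ℚ.* ε           ∎))
  where
  open ℚ.≤-Reasoning
  distance : ∀ m → ℚ.∣ a m ℚ.- l ∣ ≡ l ℚ.- a m
  distance m = trans
    (trans (cong ℚ.∣_∣ (solve 2 (λ x y → x :- y := :- (y :- x)) refl (a m) l)) (ℚ.∣-p∣≡∣p∣ (l ℚ.- a m)))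
    (ℚ.0≤p⇒∣p∣≡p (0≤l-a m))

-- Averages and order.

average : ℚ → ℚ → ℚ
average x y = ½ ℚ.* x ℚ.+ ½ ℚ.* y

average-mono : ∀ {x x′ y y′} → x ℚ.≤ x′ → y ℚ.≤ y′ → average x y ℚ.≤ average x′ y′
average-mono x≤x′ y≤y′ = ℚ.+-mono-≤ (ℚ.*-monoˡ-≤-nonNeg ½ x≤x′) (ℚ.*-monoˡ-≤-nonNeg ½ y≤y′)

average-nonNeg : ∀ {x y} → 0ℚ ℚ.≤ x → 0ℚ ℚ.≤ y → 0ℚ ℚ.≤ average x y
average-nonNeg = average-mono {0ℚ} {_} {0ℚ}

+-nonNeg : ∀ {x y} → 0ℚ ℚ.≤ x → 0ℚ ℚ.≤ y → 0ℚ ℚ.≤ x ℚ.+ y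
+-nonNeg = ℚ.+-mono-≤ {0ℚ} {_} {0ℚ}

*-nonNeg : ∀ {x y} → 0ℚ ℚ.≤ x → 0ℚ ℚ.≤ y → 0ℚ ℚ.≤ x ℚ.* y
*-nonNeg {x} {y} 0≤x 0≤y = subst (ℚ._≤ x ℚ.* y) (ℚ.*-zeroʳ x)
  (ℚ.*-monoˡ-≤-nonNeg x {{nonNegative 0≤x}} 0≤y)

x-y≤x : ∀ {x y} → 0ℚ ℚ.≤ y → x ℚ.- y ℚ.≤ x
x-y≤x {x} {y} 0≤y = subst (x ℚ.- y ℚ.≤_) (ℚ.+-identityʳ x)
  (ℚ.+-monoʳ-≤ x (ℚ.neg-antimono-≤ 0≤y))

-- Partial sums.

partialSum-suc : ∀ f N → partialSum f (suc N) ≡ f 0 ℚ.+ partialSum (λ k → f (suc k)) N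
partialSum-suc f zero    = ℚ.+-comm 0ℚ (f 0)
partialSum-suc f (suc N) = trans
  (cong (ℚ._+ f (suc N)) (partialSum-suc f N))
  (ℚ.+-assoc (f 0) (partialSum (λ k → f (suc k)) N) (f (suc N)))

partialSum-cong : ∀ {f g} → (∀ k → f k ≡ g k) → ∀ N → partialSum f N ≡ partialSum g N
partialSum-cong f≡g zero    = refl
partialSum-cong f≡g (suc N) = cong₂ ℚ._+_ (partialSum-cong f≡g N) (f≡g N)

partialSum-mono : ∀ {f g} → (∀ k → f k ℚ.≤ g k) → ∀ N → partialSum f N ℚ.≤ partialSum g N
partialSum-mono f≤g zero    = ℚ.≤-refl
partialSum-mono f≤g (suc N) = ℚ.+-mono-≤ (partialSum-mono f≤g N) (f≤g N)

partialSum-0 : ∀ N → partialSum (λ _ → 0ℚ) N ≡ 0ℚ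
partialSum-0 zero    = refl
partialSum-0 (suc N) = trans (ℚ.+-identityʳ _) (partialSum-0 N)

partialSum-average : ∀ f g h N →
  partialSum (λ k → average (f k) (g k) ℚ.+ h k) N
    ≡ average (partialSum f N) (partialSum g N) ℚ.+ partialSum h N
partialSum-average f g h zero    = refl
partialSum-average f g h (suc N) = trans
  (cong (ℚ._+ (average (f N) (g N) ℚ.+ h N)) (partialSum-average f g h N))
  (solve 6 (λ F G H x y z →
      (con ½ :* F :+ con ½ :* G :+ H) :+ (con ½ :* x :+ con ½ :* y :+ z)
        := con ½ :* (F :+ x) :+ con ½ :* (G :+ y) :+ (H :+ z)) refl
    (partialSum f N) (partialSum g N) (partialSum h N) (f N) (g N) (h N))

-- Each of the `N` summands `f 0`, ..., `f (N - 1)` is at least `f N`.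
nonincreasing⇒N*f≤sum : ∀ {f} → (∀ k → f (suc k) ℚ.≤ f k) →
  ∀ N → ι (+ N) ℚ.* f N ℚ.≤ partialSum f N
nonincreasing⇒N*f≤sum {f} f↓ zero    = ℚ.≤-reflexive (ℚ.*-zeroˡ (f 0))
nonincreasing⇒N*f≤sum {f} f↓ (suc N) = begin
  ι (+ suc N) ℚ.* f (suc N)        ≤⟨ ℚ.*-monoˡ-≤-nonNeg (ι (+ suc N)) {{ι-nonNeg (suc N)}} (f↓ N) ⟩
  ι (+ suc N) ℚ.* f N              ≡⟨ cong (ℚ._* f N) (ι-suc N) ⟩
  (1ℚ ℚ.+ ι (+ N)) ℚ.* f N         ≡⟨ solve 2 (λ x y → (con 1ℚ :+ x) :* y := x :* y :+ y) refl (ι (+ N)) (f N) ⟩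
  ι (+ N) ℚ.* f N ℚ.+ f N          ≤⟨ ℚ.+-monoˡ-≤ (f N) (nonincreasing⇒N*f≤sum f↓ N) ⟩
  partialSum f N ℚ.+ f N           ∎
  where open ℚ.≤-Reasoning

remainder-↓ : ∀ l f → (∀ k → 0ℚ ℚ.≤ f k) →
  ∀ N → l ℚ.- partialSum f (suc N) ℚ.≤ l ℚ.- partialSum f N
remainder-↓ l f 0≤f N = subst (ℚ._≤ l ℚ.- partialSum f N)
  (solve 3 (λ x y z → x :- y :- z := x :- (y :+ z)) refl l (partialSum f N) (f N))
  (x-y≤x (0≤f N))

-- Expectations over fair turns and the law of the duration.

𝔼-nonNeg : ∀ k f → (∀ w → 0ℚ ℚ.≤ f w) → 0ℚ ℚ.≤ 𝔼 ½ k f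
𝔼-nonNeg zero    f 0≤f = 0≤f _
𝔼-nonNeg (suc k) f 0≤f = average-nonNeg
  (𝔼-nonNeg k _ (λ w → 0≤f (win ∷ w))) (𝔼-nonNeg k _ (λ w → 0≤f (lose ∷ w)))

𝔼-0 : ∀ k → 𝔼 ½ k (λ _ → 0ℚ) ≡ 0ℚ
𝔼-0 zero    = refl
𝔼-0 (suc k) = cong₂ average (𝔼-0 k) (𝔼-0 k)

module _ (u n : ℕ) where

  law-nonNeg : ∀ s k → 0ℚ ℚ.≤ law ½ u n s k
  law-nonNeg s k = 𝔼-nonNeg k _ (λ w → indicator (endsNow u n s w))
    where
    indicator : ∀ b → 0ℚ ℚ.≤ (if b then 1ℚ else 0ℚ)
    indicator true  = ℚ.nonNegative⁻¹ 1ℚ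
    indicator false = ℚ.≤-refl

  law-n-0 : law ½ u n n 0 ≡ 1ℚ
  law-n-0 = cong (λ b → if b then 1ℚ else 0ℚ) (dec-true (n ℕ.≟ n) refl)

  law-n-suc : ∀ k → law ½ u n n (suc k) ≡ 0ℚ
  law-n-suc k rewrite dec-true (n ℕ.≟ n) refl = cong₂ average (𝔼-0 k) (𝔼-0 k)

  law-0 : ∀ {s} → s ℕ.< n → law ½ u n s 0 ≡ 0ℚ
  law-0 {s} s<n = cong (λ b → if b then 1ℚ else 0ℚ) (dec-false (s ℕ.≟ n) (ℕ.<⇒≢ s<n))

  -- Conditioning on the first turn. Since `1ℚ - ½` evaluates to `½`, the definition of `𝔼` unfolds
  -- to `average` once the test at time 0 is decided.
  law-suc : ∀ {s} → s ℕ.< n → ∀ k →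
    law ½ u n s (suc k) ≡ average (law ½ u n (s ℕ.+ 1) k) (law ½ u n (s ∸ u) k)
  law-suc {s} s<n k rewrite dec-false (s ℕ.≟ n) (ℕ.<⇒≢ s<n) = refl

-- Recurrence and monotonicity of `C u`.

-- Truncation at the boundary is harmless because C vanishes at arguments ≤ 0.
Cback-∸ : ∀ u s j → Cback u s j ≡ C u (+ (s ∸ j))
Cback-∸ u zero    zero    = refl
Cback-∸ u zero    (suc j) = refl
Cback-∸ u (suc s) zero    = refl
Cback-∸ u (suc s) (suc j) = Cback-∸ u s j

C-suc : ∀ u s → C u (+ suc s) ≡ + 2 * C u (+ s) ℤ.+ + 1 - C u (+ (s ∸ u))
C-suc u s = cong (λ i → + 2 * C u (+ s) ℤ.+ + 1 - i) (Cback-∸ u s u)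

-- The recurrence reads C(s+1) - C(s) = 1 + (C(s) - C(s ∸ u)), and the bracket is nonnegative by
-- induction because `s ∸ u ≤ s`.
C-mono : ∀ u {r s} → r ≤ s → C u (+ r) ℤ.≤ C u (+ s)
C-mono u {s = zero}  z≤n = ℤ.≤-refl
C-mono u {r} {suc s} r≤1+s with ℕ.m≤n⇒m<n∨m≡n r≤1+s
... | inj₂ refl      = ℤ.≤-refl
... | inj₁ (s≤s r≤s) = ℤ.≤-trans (C-mono u r≤s) (begin
  c                                   ≡⟨ ℤ.+-identityʳ c ⟨
  c ℤ.+ 0ℤ                            ≤⟨ ℤ.+-monoʳ-≤ c (ℤ.i≤j⇒0≤j-i (C-mono u (ℕ.m∸n≤m s u))) ⟩
  c ℤ.+ (c - d)                       ≤⟨ ℤ.i≤j+i _ (+ 1) ⟩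
  + 1 ℤ.+ (c ℤ.+ (c - d))             ≡⟨ rearrange c d ⟩
  + 2 * c ℤ.+ + 1 - d                 ≡⟨ C-suc u s ⟨
  C u (+ suc s)                       ∎)
  where
  open ℤ.≤-Reasoning
  c = C u (+ s)
  d = C u (+ (s ∸ u))
  rearrange : ∀ x y → + 1 ℤ.+ (x ℤ.+ (x - y)) ≡ + 2 * x ℤ.+ + 1 - y
  rearrange = ℤ.solve-∀

-- The candidate expectation `V`.

module _ (u n : ℕ) where

  V : ℕ → ℚ
  V s = ι (+ 2 * (C u (+ n) - C u (+ s)))

  V-nonNeg : ∀ {s} → s ≤ n → 0ℚ ℚ.≤ V s
  V-nonNeg s≤n = ι-mono (ℤ.*-monoˡ-≤-nonNeg (+ 2) (ℤ.i≤j⇒0≤j-i (C-mono u s≤n)))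

  V≤V0 : ∀ s → V s ℚ.≤ V 0
  V≤V0 s = ι-mono (ℤ.*-monoˡ-≤-nonNeg (+ 2)
    (ℤ.+-monoʳ-≤ (C u (+ n)) (ℤ.neg-mono-≤ (C-mono u {0} {s} z≤n))))

  V-n : V n ≡ 0ℚ
  V-n = cong (λ i → ι (+ 2 * i)) (ℤ.+-inverseʳ (C u (+ n)))

  -- The recurrence gives C(s+1) + C(s ∸ u) = 2 C(s) + 1, hence V(s+1) + V(s ∸ u) = 2 V(s) - 2.
  -- Doubling `V s` first lets this be checked over the integers.
  V-average : ∀ s → V s ≡ 1ℚ ℚ.+ average (V (s ℕ.+ 1)) (V (s ∸ u))
  V-average s = begin
    V s                                              ≡⟨ solve 1 (λ x → x := con ½ :* (x :+ x)) refl (V s) ⟩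
    ½ ℚ.* (V s ℚ.+ V s)                              ≡⟨ cong (½ ℚ.*_) (ι-+ v v) ⟨
    ½ ℚ.* ι (v ℤ.+ v)                                ≡⟨ cong (λ i → ½ ℚ.* ι i) doubled ⟩
    ½ ℚ.* ι (+ 2 ℤ.+ (w ℤ.+ l))                      ≡⟨ cong (½ ℚ.*_) (trans (ι-+ (+ 2) (w ℤ.+ l)) (cong (ι (+ 2) ℚ.+_) (ι-+ w l))) ⟩
    ½ ℚ.* (ι (+ 2) ℚ.+ (V (s ℕ.+ 1) ℚ.+ V (s ∸ u)))  ≡⟨ solve 2 (λ x y → con ½ :* (con (ι (+ 2)) :+ (x :+ y)) := con 1ℚ :+ (con ½ :* x :+ con ½ :* y)) refl (V (s ℕ.+ 1)) (V (s ∸ u)) ⟩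
    1ℚ ℚ.+ average (V (s ℕ.+ 1)) (V (s ∸ u))         ∎
    where
    open ≡-Reasoning
    v = + 2 * (C u (+ n) - C u (+ s))
    w = + 2 * (C u (+ n) - C u (+ (s ℕ.+ 1)))
    l = + 2 * (C u (+ n) - C u (+ (s ∸ u)))
    rearrange : ∀ a c d → + 2 * (a - c) ℤ.+ + 2 * (a - c)
      ≡ + 2 ℤ.+ (+ 2 * (a - (+ 2 * c ℤ.+ + 1 - d)) ℤ.+ + 2 * (a - d))
    rearrange = ℤ.solve-∀
    doubled : v ℤ.+ v ≡ + 2 ℤ.+ (w ℤ.+ l)
    doubled rewrite ℕ.+-comm s 1 | C-suc u s = rearrange (C u (+ n)) (C u (+ s)) (C u (+ (s ∸ u)))

  -- Families governed by the first-step recurrence.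

  win≤n : ∀ {s} → s ℕ.< n → s ℕ.+ 1 ≤ n
  win≤n {s} s<n = subst (_≤ n) (ℕ.+-comm 1 s) s<n

  lose≤n : ∀ {s} → s ℕ.< n → s ∸ u ≤ n
  lose≤n {s} s<n = ℕ.≤-trans (ℕ.m∸n≤m s u) (ℕ.<⇒≤ s<n)

  -- Time `N`, starting position `s`, source term `H`. Absorption at `n` is imposed only from time 1
  -- on, because the tail has value 1 at time 0 even there.
  record Evolves (R H : ℕ → ℕ → ℚ) : Set where
    field
      initial  : ∀ {s} → s ≤ n → 0ℚ ℚ.≤ R 0 s
      absorbed : ∀ N → R (suc N) n ≡ 0ℚ
      averaged : ∀ {s} → s ℕ.< n → ∀ N →
        R (suc N) s ≡ average (R N (s ℕ.+ 1)) (R N (s ∸ u)) ℚ.+ H N s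

  module _ {R H} (ev : Evolves R H) where
    open Evolves ev

    evolves-nonNeg : (∀ N {s} → s ≤ n → 0ℚ ℚ.≤ H N s) → ∀ N {s} → s ≤ n → 0ℚ ℚ.≤ R N s
    evolves-nonNeg 0≤H zero    s≤n = initial s≤n
    evolves-nonNeg 0≤H (suc N) s≤n with ℕ.m≤n⇒m<n∨m≡n s≤n
    ... | inj₂ refl = ℚ.≤-reflexive (≡.sym (absorbed N))
    ... | inj₁ s<n  = subst (0ℚ ℚ.≤_) (≡.sym (averaged s<n N)) (+-nonNeg
      (average-nonNeg (evolves-nonNeg 0≤H N (win≤n s<n)) (evolves-nonNeg 0≤H N (lose≤n s<n)))
      (0≤H N s≤n))

    -- `c (1 + V)` is a supersolution of the summed recurrence: initial value and sources contribute
    -- at most `c`, and `c + c (1 + average of V) = c (1 + V s)` by the equation for `V`. The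
    -- summand 1 covers `s = n`, where `V` vanishes but the initial value may be as large as `c`.
    evolves-sum : ∀ c → 0ℚ ℚ.≤ c →
      (∀ N {s} → s ≤ n → R 0 s ℚ.+ partialSum (λ k → H k s) N ℚ.≤ c) →
      ∀ N {s} → s ≤ n → partialSum (λ k → R k s) N ℚ.≤ c ℚ.* (1ℚ ℚ.+ V s)
    evolves-sum c 0≤c source zero s≤n =
      *-nonNeg 0≤c (+-nonNeg (ℚ.nonNegative⁻¹ 1ℚ) (V-nonNeg s≤n))
    evolves-sum c 0≤c source (suc N) {s} s≤n with ℕ.m≤n⇒m<n∨m≡n s≤n
    ... | inj₂ refl = begin
      partialSum (λ k → R k n) (suc N)              ≡⟨ partialSum-suc (λ k → R k n) N ⟩
      R 0 n ℚ.+ partialSum (λ k → R (suc k) n) N    ≡⟨ cong (R 0 n ℚ.+_) (trans (partialSum-cong absorbed N) (partialSum-0 N)) ⟩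
      -- The `0ℚ` is the empty sum of sources, so the hypothesis applies at time 0.
      R 0 n ℚ.+ 0ℚ                                  ≤⟨ source 0 s≤n ⟩
      c                                             ≡⟨ ℚ.*-identityʳ c ⟨
      c ℚ.* (1ℚ ℚ.+ 0ℚ)                             ≡⟨ cong (λ v → c ℚ.* (1ℚ ℚ.+ v)) V-n ⟨
      c ℚ.* (1ℚ ℚ.+ V n)                            ∎
      where open ℚ.≤-Reasoning
    ... | inj₁ s<n  = begin
      partialSum (λ k → R k s) (suc N)
        ≡⟨ partialSum-suc (λ k → R k s) N ⟩
      R 0 s ℚ.+ partialSum (λ k → R (suc k) s) N
        ≡⟨ cong (R 0 s ℚ.+_) (trans (partialSum-cong (averaged s<n) N) (partialSum-average _ _ _ N)) ⟩
      R 0 s ℚ.+ (average ΣR⁺ ΣR⁻ ℚ.+ ΣH)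
        ≡⟨ solve 3 (λ x y z → x :+ (y :+ z) := (x :+ z) :+ y) refl (R 0 s) (average ΣR⁺ ΣR⁻) ΣH ⟩
      R 0 s ℚ.+ ΣH ℚ.+ average ΣR⁺ ΣR⁻
        ≤⟨ ℚ.+-mono-≤ (source N s≤n) (average-mono
             (evolves-sum c 0≤c source N (win≤n s<n)) (evolves-sum c 0≤c source N (lose≤n s<n))) ⟩
      c ℚ.+ average (c ℚ.* (1ℚ ℚ.+ V (s ℕ.+ 1))) (c ℚ.* (1ℚ ℚ.+ V (s ∸ u)))
        ≡⟨ solve 3 (λ x y z → x :+ (con ½ :* (x :* (con 1ℚ :+ y)) :+ con ½ :* (x :* (con 1ℚ :+ z)))
             := x :* (con 1ℚ :+ (con 1ℚ :+ (con ½ :* y :+ con ½ :* z)))) refl c (V (s ℕ.+ 1)) (V (s ∸ u)) ⟩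
      c ℚ.* (1ℚ ℚ.+ (1ℚ ℚ.+ average (V (s ℕ.+ 1)) (V (s ∸ u))))
        ≡⟨ cong (λ v → c ℚ.* (1ℚ ℚ.+ v)) (V-average s) ⟨
      c ℚ.* (1ℚ ℚ.+ V s)
        ∎
      where
      open ℚ.≤-Reasoning
      ΣR⁺ = partialSum (λ k → R k (s ℕ.+ 1)) N
      ΣR⁻ = partialSum (λ k → R k (s ∸ u)) N
      ΣH  = partialSum (λ k → H k s) N

  -- Truncated probabilities and expectations of the duration, and their defects.

  P T M W : ℕ → ℕ → ℚ
  P N s = partialSum (law ½ u n s) N
  T N s = 1ℚ ℚ.- P N s
  M N s = partialSum (λ k → ι (+ k) ℚ.* law ½ u n s k) N
  W N s = V s ℚ.- M N s

  P-step : ∀ {s} → s ℕ.< n → ∀ N → P (suc N) s ≡ average (P N (s ℕ.+ 1)) (P N (s ∸ u))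
  P-step {s} s<n N = begin
    P (suc N) s                                                 ≡⟨ partialSum-suc f N ⟩
    f 0 ℚ.+ partialSum (λ k → f (suc k)) N                      ≡⟨ cong₂ ℚ._+_ (law-0 u n s<n) (partialSum-cong (λ k → trans (law-suc u n s<n k) (≡.sym (ℚ.+-identityʳ _))) N) ⟩
    0ℚ ℚ.+ partialSum (λ k → average (f⁺ k) (f⁻ k) ℚ.+ 0ℚ) N    ≡⟨ ℚ.+-identityˡ _ ⟩
    partialSum (λ k → average (f⁺ k) (f⁻ k) ℚ.+ 0ℚ) N           ≡⟨ partialSum-average f⁺ f⁻ (λ _ → 0ℚ) N ⟩
    average (P N (s ℕ.+ 1)) (P N (s ∸ u)) ℚ.+ partialSum (λ _ → 0ℚ) N
                                                                ≡⟨ trans (cong (average (P N (s ℕ.+ 1)) (P N (s ∸ u)) ℚ.+_) (partialSum-0 N)) (ℚ.+-identityʳ _) ⟩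
    average (P N (s ℕ.+ 1)) (P N (s ∸ u))                       ∎
    where
    open ≡-Reasoning
    f f⁺ f⁻ : ℕ → ℚ
    f  = law ½ u n s
    f⁺ = law ½ u n (s ℕ.+ 1)
    f⁻ = law ½ u n (s ∸ u)

  -- A game lasting `k + 1` turns lasts `k` turns after the first one. The extra turn is counted
  -- with total weight the sum of `f (suc k)` over `k < N`, which is `P (suc N) s` because `f 0`
  -- vanishes for `s < n`.
  M-step : ∀ {s} → s ℕ.< n → ∀ N →
    M (suc N) s ≡ average (M N (s ℕ.+ 1)) (M N (s ∸ u)) ℚ.+ P (suc N) s
  M-step {s} s<n N = begin
    M (suc N) s
      ≡⟨ partialSum-suc (λ k → ι (+ k) ℚ.* f k) N ⟩
    0ℚ ℚ.* f 0 ℚ.+ partialSum (λ k → ι (+ suc k) ℚ.* f (suc k)) N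
      ≡⟨ cong₂ ℚ._+_ (ℚ.*-zeroˡ (f 0)) (partialSum-cong term N) ⟩
    0ℚ ℚ.+ partialSum (λ k → average (ι (+ k) ℚ.* f⁺ k) (ι (+ k) ℚ.* f⁻ k) ℚ.+ f (suc k)) N
      ≡⟨ trans (ℚ.+-identityˡ _) (partialSum-average _ _ _ N) ⟩
    average (M N (s ℕ.+ 1)) (M N (s ∸ u)) ℚ.+ partialSum (λ k → f (suc k)) N
      ≡⟨ cong (average (M N (s ℕ.+ 1)) (M N (s ∸ u)) ℚ.+_) shift ⟨
    average (M N (s ℕ.+ 1)) (M N (s ∸ u)) ℚ.+ P (suc N) s
      ∎
    where
    open ≡-Reasoning
    f f⁺ f⁻ : ℕ → ℚ
    f  = law ½ u n s
    f⁺ = law ½ u n (s ℕ.+ 1)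
    f⁻ = law ½ u n (s ∸ u)
    shift : P (suc N) s ≡ partialSum (λ k → f (suc k)) N
    shift = trans (partialSum-suc f N) (trans (cong (ℚ._+ partialSum (λ k → f (suc k)) N) (law-0 u n s<n)) (ℚ.+-identityˡ _))
    term : ∀ k → ι (+ suc k) ℚ.* f (suc k)
      ≡ average (ι (+ k) ℚ.* f⁺ k) (ι (+ k) ℚ.* f⁻ k) ℚ.+ f (suc k)
    term k rewrite ι-suc k | law-suc u n s<n k =
      solve 3 (λ i x y → (con 1ℚ :+ i) :* (con ½ :* x :+ con ½ :* y)
        := (con ½ :* (i :* x) :+ con ½ :* (i :* y)) :+ (con ½ :* x :+ con ½ :* y))
        refl (ι (+ k)) (f⁺ k) (f⁻ k)

  P-n : ∀ N → P (suc N) n ≡ 1ℚ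
  P-n N = trans (partialSum-suc (law ½ u n n) N)
    (cong₂ ℚ._+_ (law-n-0 u n) (trans (partialSum-cong (law-n-suc u n) N) (partialSum-0 N)))

  M-n : ∀ N → M N n ≡ 0ℚ
  M-n N = trans (partialSum-cong term N) (partialSum-0 N)
    where
    term : ∀ k → ι (+ k) ℚ.* law ½ u n n k ≡ 0ℚ
    term zero    = ℚ.*-zeroˡ (law ½ u n n 0)
    term (suc k) = trans (cong (ι (+ suc k) ℚ.*_) (law-n-suc u n k)) (ℚ.*-zeroʳ (ι (+ suc k)))

  T-evolves : Evolves T (λ _ _ → 0ℚ)
  T-evolves = record
    { initial  = λ _ → ℚ.nonNegative⁻¹ 1ℚ
    ; absorbed = λ N → cong (λ x → 1ℚ ℚ.- x) (P-n N)
    ; averaged = λ {s} s<n N → trans (cong (λ x → 1ℚ ℚ.- x) (P-step s<n N))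
        (solve 2 (λ x y → con 1ℚ :- (con ½ :* x :+ con ½ :* y)
          := (con ½ :* (con 1ℚ :- x) :+ con ½ :* (con 1ℚ :- y)) :+ con 0ℚ)
          refl (P N (s ℕ.+ 1)) (P N (s ∸ u)))
    }

  -- Subtracting the recurrences, the 1 from `V-average` and the `P (suc N) s` from `M-step` combine
  -- into the source `T (suc N) s`.
  W-evolves : Evolves W (λ N → T (suc N))
  W-evolves = record
    { initial  = λ {s} s≤n → subst (0ℚ ℚ.≤_) (≡.sym (ℚ.+-identityʳ (V s))) (V-nonNeg s≤n)
    ; absorbed = λ N → cong₂ ℚ._-_ V-n (M-n (suc N))
    ; averaged = λ {s} s<n N → trans (cong₂ ℚ._-_ (V-average s) (M-step s<n N))
        (solve 5 (λ v⁺ v⁻ m⁺ m⁻ p →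
            (con 1ℚ :+ (con ½ :* v⁺ :+ con ½ :* v⁻)) :- ((con ½ :* m⁺ :+ con ½ :* m⁻) :+ p)
              := (con ½ :* (v⁺ :- m⁺) :+ con ½ :* (v⁻ :- m⁻)) :+ (con 1ℚ :- p))
          refl (V (s ℕ.+ 1)) (V (s ∸ u)) (M N (s ℕ.+ 1)) (M N (s ∸ u)) (P (suc N) s))
    }

  -- Bounds `P` by 1 through the recurrence with zero source, in place of disjointness of the events
  -- X = k.
  T-nonNeg : ∀ N {s} → s ≤ n → 0ℚ ℚ.≤ T N s
  T-nonNeg = evolves-nonNeg T-evolves (λ _ _ → ℚ.≤-refl)

  W-nonNeg : ∀ N {s} → s ≤ n → 0ℚ ℚ.≤ W N s
  W-nonNeg = evolves-nonNeg W-evolves (λ N → T-nonNeg (suc N))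

  T-↓ : ∀ N s → T (suc N) s ℚ.≤ T N s
  T-↓ N s = remainder-↓ 1ℚ (law ½ u n s) (law-nonNeg u n s) N

  W-↓ : ∀ N s → W (suc N) s ℚ.≤ W N s
  W-↓ N s = remainder-↓ (V s) (λ k → ι (+ k) ℚ.* law ½ u n s k)
    (λ k → *-nonNeg (ι-mono {+ 0} {+ k} (ℤ.+≤+ z≤n)) (law-nonNeg u n s k)) N

  -- The constant is 1 because `T 0 s = 1` and there is no source. The sum of P(X ≥ k) over all `k`
  -- is 1 + E[X], so this is the bound to expect.
  ΣT≤1+V : ∀ N {s} → s ≤ n → partialSum (λ k → T k s) N ℚ.≤ 1ℚ ℚ.+ V s
  ΣT≤1+V N {s} s≤n = subst (partialSum (λ k → T k s) N ℚ.≤_) (ℚ.*-identityˡ (1ℚ ℚ.+ V s))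
    (evolves-sum T-evolves 1ℚ (ℚ.nonNegative⁻¹ 1ℚ)
      (λ N _ → ℚ.≤-reflexive (cong (1ℚ ℚ.+_) (partialSum-0 N))) N s≤n)

  -- Bounds the initial value `W 0 s = V s` by `V 0`, plus the accumulated source by `1 + V 0`,
  -- uniformly in `s` and `N`.
  K : ℚ
  K = V 0 ℚ.+ (1ℚ ℚ.+ V 0)

  0≤K : 0ℚ ℚ.≤ K
  0≤K = +-nonNeg (V-nonNeg z≤n) (+-nonNeg (ℚ.nonNegative⁻¹ 1ℚ) (V-nonNeg z≤n))

  ΣW≤K[1+V] : ∀ N {s} → s ≤ n → partialSum (λ k → W k s) N ℚ.≤ K ℚ.* (1ℚ ℚ.+ V s)
  ΣW≤K[1+V] = evolves-sum W-evolves K 0≤K λ N {s} s≤n → begin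
    -- Monotonicity of the tail undoes the index shift in the source.
    V s ℚ.- 0ℚ ℚ.+ partialSum (λ k → T (suc k) s) N  ≤⟨ ℚ.+-mono-≤ (x-y≤x {V s} ℚ.≤-refl) (partialSum-mono (λ k → T-↓ k s) N) ⟩
    V s ℚ.+ partialSum (λ k → T k s) N               ≤⟨ ℚ.+-mono-≤ (V≤V0 s) (ΣT≤1+V N s≤n) ⟩
    V 0 ℚ.+ (1ℚ ℚ.+ V s)                             ≤⟨ ℚ.+-monoʳ-≤ (V 0) (ℚ.+-monoʳ-≤ 1ℚ (V≤V0 s)) ⟩
    K                                                ∎
    where open ℚ.≤-Reasoning

proposition11 : (u : ℕ) → 1 ≤ u → (n s : ℕ) → s ≤ n →
    HasExpectation (law ½ u n s) ((+ 2 * (C u (+ n) - C u (+ s))) / 1)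
proposition11 u _ n s s≤n =
    -- In both components `N` times the remainder is at most the sum of the first `N` remainders,
    -- which is bounded independently of `N`.
    ⟶-by-1/N (λ N → P u n N s) 1ℚ (1ℚ ℚ.+ V u n s) (λ N → T-nonNeg u n N s≤n)
      (λ N → ℚ.≤-trans (nonincreasing⇒N*f≤sum (λ k → T-↓ u n k s) N) (ΣT≤1+V u n N s≤n))
  , ⟶-by-1/N (λ N → M u n N s) (V u n s) (K u n ℚ.* (1ℚ ℚ.+ V u n s)) (λ N → W-nonNeg u n N s≤n)
      (λ N → ℚ.≤-trans (nonincreasing⇒N*f≤sum (λ k → W-↓ u n k s) N) (ΣW≤K[1+V] u n N s≤n))
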